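{- For a countably infinite connected graph $G$, the following are equivalent: $G$ is HE-homogeneous; $G$ is ME-homogeneous; $G$ is MB-homogeneous.
   Context: All graphs are undirected and loopless; subgraphs are induced. A homomorphism maps adjacent vertices to adjacent vertices; a monomorphism is an injective homomorphism; a bimorphism of $G$ is a bijective endomorphism $G\to G$. A countable graph $G$ is HE-homogeneous (resp. ME-homogeneous) if every homomorphism (resp. monomorphism) between finite induced subgraphs of $G$ is the restriction of a surjective endomorphism of $G$; it is MB-homogeneous if every monomorphism between finite induced subgraphs of $G$ is the restriction of a bimorphism of $G$. -}

module Defs where

open import Data.Fin.Base using (Fin)
open import Data.Nat.Base using (ℕ)
open import Data.Product.Base using (_×_; ∃-syntax)
open import Function.Base using (_on_)
open import Function.Bundles using (_↔_; _↣_; Injection)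
open import Function.Definitions using (Injective; Surjective; Bijective)
open import Level using (Level; suc; _⊔_)
open import Relation.Binary.Construct.Closure.ReflexiveTransitive using (Star)
open import Relation.Binary.Core using (Rel; _=[_]⇒_)
open import Relation.Binary.Definitions using (Symmetric; Irreflexive)
open import Relation.Binary.PropositionalEquality using (_≡_; cong)

private
  variable
    a b e e′ : Level

record Graph (a e : Level) : Set (suc (a ⊔ e)) where
  field
    Vertex : Set a
    Adj    : Rel Vertex e
    sym    : Symmetric Adj
    irrefl : Irreflexive _≡_ Adj

open Graph public using (Vertex; Adj)

CountablyInfinite : Graph a e → Set a
CountablyInfinite G = Vertex G ↔ ℕ

-- An element of Star (Adj G) x y is a finite walk from x to y.
Connected : Graph a e → Set (a ⊔ e)
Connected G = ∀ x y → Star (Adj G) x y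

module _ (G : Graph a e) (H : Graph b e′) where

  IsHomomorphism : (Vertex G → Vertex H) → Set (a ⊔ e ⊔ e′)
  IsHomomorphism f = Adj G =[ f ]⇒ Adj H

  -- Unlike the library's IsRelMonomorphism, this does not require that
  -- adjacency be reflected.
  IsMonomorphism : (Vertex G → Vertex H) → Set (a ⊔ b ⊔ e ⊔ e′)
  IsMonomorphism f = IsHomomorphism f × Injective _≡_ _≡_ f

module _ (G : Graph a e) where

  IsSurjectiveEndomorphism : (Vertex G → Vertex G) → Set (a ⊔ e)
  IsSurjectiveEndomorphism F = IsHomomorphism G G F × Surjective _≡_ _≡_ F

  IsBimorphism : (Vertex G → Vertex G) → Set (a ⊔ e)
  IsBimorphism F = IsHomomorphism G G F × Bijective _≡_ _≡_ F

-- A finite induced subgraph is given by a finite set of vertices, presented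
-- by a repetition-free enumeration.
record FiniteInducedSubgraph (G : Graph a e) : Set a where
  field
    size      : ℕ
    inclusion : Fin size ↣ Vertex G

  vertex : Fin size → Vertex G
  vertex = Injection.to inclusion

open FiniteInducedSubgraph public using (size; vertex)

induced : (G : Graph a e) → FiniteInducedSubgraph G → Graph _ e
induced G A = record
  { Vertex = Fin (size A)
  ; Adj    = Adj G on vertex A
  ; sym    = Graph.sym G
  ; irrefl = λ i≡j → Graph.irrefl G (cong (vertex A) i≡j)
  }

module _ (G : Graph a e) (A B : FiniteInducedSubgraph G) where

  -- f, regarded as a map between sets of vertices of G, is the restriction
  -- of F to A.
  IsRestrictionOf : (Fin (size A) → Fin (size B)) →
                    (Vertex G → Vertex G) → Set a
  IsRestrictionOf f F = ∀ i → F (vertex A i) ≡ vertex B (f i)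

module _ (G : Graph a e) where

  HE-Homogeneous : Set (a ⊔ e)
  HE-Homogeneous =
    ∀ (A B : FiniteInducedSubgraph G) f →
    IsHomomorphism (induced G A) (induced G B) f →
    ∃[ F ] IsSurjectiveEndomorphism G F × IsRestrictionOf G A B f F

  ME-Homogeneous : Set (a ⊔ e)
  ME-Homogeneous =
    ∀ (A B : FiniteInducedSubgraph G) f →
    IsMonomorphism (induced G A) (induced G B) f →
    ∃[ F ] IsSurjectiveEndomorphism G F × IsRestrictionOf G A B f F

  MB-Homogeneous : Set (a ⊔ e)
  MB-Homogeneous =
    ∀ (A B : FiniteInducedSubgraph G) f →
    IsMonomorphism (induced G A) (induced G B) f →
    ∃[ F ] IsBimorphism G F × IsRestrictionOf G A B f F

{-# OPTIONS --safe #-}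

-- In a homogeneous graph the back condition comes from surjectivity; what is missing for
-- MB-homogeneity is that every finite set has a cone (a common neighbour), since a cone of the
-- image can always be taken as the value at a new point. Complete graphs have this property.
-- Otherwise any two vertices of a connected ME-homogeneous graph have a common neighbour.
-- Suppose n ≥ 2 is maximal such that all n-sets have cones. Some vertex has infinite degree, so
-- there are arbitrarily large cliques; as some finite set has no cone, one of its points misses
-- arbitrarily large cliques, and going back from these every finite set has an isolated point.
-- No independent (n+1)-set has a cone, so every neighbour of a cone of an independent n-set J
-- lies in J or is adjacent to a point of J. This yields cones of all (n+1)-sets containing an
-- edge and of all (n+2)-sets containing a triangle or two disjoint edges, hence three pairwise
-- adjacent cones x, y, z of n-sets with empty intersection, and a cone of
-- x, y, z and n-1 isolated points has n+1 independent neighbours, a contradiction.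
--
-- For HE-homogeneity the back condition must be shown for homomorphisms. The forth and back
-- conditions for monomorphisms are exchanged by complementation, so the above applies to the
-- complement: either every finite set has an isolated point, which can serve as the preimage, or
-- non-adjacency is transitive and the preimage is found directly.

module Submission where

open import Defs
open import Axiom.ExcludedMiddle using (ExcludedMiddle)
open import Data.Empty using (⊥; ⊥-elim)
import Data.Fin.Base as Fin
import Data.Fin.Properties as Fin
open import Data.List.Base using (List; []; _∷_; _++_; length; map; zip; lookup; deduplicate; concatMap)
open import Data.List.Membership.Propositional using (_∈_; find; lose)
open import Data.List.Membership.Propositional.Properties
  using (∈-∃++; ∈-++⁺ˡ; ∈-++⁺ʳ; ∈-deduplicate⁺; ∈-concatMap⁺; ∈-tabulate⁺; ∈-lookup)
open import Data.List.Relation.Binary.Permutation.Propositional using (_↭_; ↭-sym; ↭⇒↭ₛ)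
open import Data.List.Relation.Binary.Permutation.Propositional.Properties
  using (All-resp-↭; ↭-length; ∈-resp-↭; shift)
import Data.List.Relation.Binary.Permutation.Setoid.Properties as ↭ₛ
open import Data.List.Relation.Binary.Sublist.Propositional using (_⊆_; []; _∷_; _∷ʳ_; minimum)
open import Data.List.Relation.Binary.Sublist.Propositional.Properties using (All-resp-⊆)
open import Data.List.Relation.Binary.Subset.Propositional using () renaming (_⊆_ to _⊑_)
open import Data.List.Relation.Unary.All as All using (All; []; _∷_)
import Data.List.Relation.Unary.All.Properties as All
open import Data.List.Relation.Unary.AllPairs as AllPairs using (AllPairs; []; _∷_)
import Data.List.Relation.Unary.AllPairs.Properties as AllPairs
open import Data.List.Relation.Unary.Any using (here; there; any?; index)
open import Data.List.Relation.Unary.Any.Properties using (lookup-index)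
import Data.List.Relation.Unary.Unique.DecPropositional.Properties as UniqueDec
open import Data.List.Relation.Unary.Unique.Propositional using (Unique)
open import Data.Nat.Base using (ℕ; zero; suc; _+_; _≤_)
open import Data.Nat.ListAction using (sum)
open import Data.Nat.Properties using (+-comm; +-suc; suc-injective; ≤-trans; <-irrefl; m≤m+n; m≤n+m)
open import Data.Product.Base using (∃; ∃₂; _×_; _,_; proj₁; proj₂; swap)
open import Data.Sum.Base using (_⊎_; inj₁; inj₂)
open import Function.Base using (_∘_; id)
open import Function.Bundles using (_⇔_; _↔_; mk⇔; mk↣; Injection; Inverse)
open import Level using (Level; _⊔_; Lift; lift; lower)
open import Relation.Binary.Construct.Closure.ReflexiveTransitive using (Star; ε; _◅_)
open import Relation.Binary.Core using (Rel)
open import Relation.Binary.Definitions using (Symmetric; DecidableEquality) renaming (Decidable to Decidable₂)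
open import Relation.Binary.PropositionalEquality
  using (_≡_; _≢_; refl; sym; trans; cong; subst; subst₂; ≢-sym; setoid; resp₂)
open import Relation.Nullary.Decidable using (yes; no; map′; decidable-stable; ¬?)
open import Relation.Nullary.Negation using (¬_; contradiction)
open import Relation.Unary using (Pred; Decidable)

private
  variable
    a b e ℓ ℓ₁ ℓ₂ : Level

-- Lists: zips, permutations, sublists and a pigeonhole principle.

module _ {A : Set a} {B : Set b} where

  map-proj₁-zip : ∀ (xs : List A) (ys : List B) → length xs ≡ length ys → map proj₁ (zip xs ys) ≡ xs
  map-proj₁-zip []       []       _  = refl
  map-proj₁-zip (x ∷ xs) (y ∷ ys) eq = cong (x ∷_) (map-proj₁-zip xs ys (suc-injective eq))

  map-proj₂-zip : ∀ (xs : List A) (ys : List B) → length xs ≡ length ys → map proj₂ (zip xs ys) ≡ ys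
  map-proj₂-zip []       []       _  = refl
  map-proj₂-zip (x ∷ xs) (y ∷ ys) eq = cong (y ∷_) (map-proj₂-zip xs ys (suc-injective eq))

  All-zip : ∀ {P : Pred A ℓ₁} {Q : Pred B ℓ₂} {xs ys} → All P xs → All Q ys →
            All (λ r → P (proj₁ r) × Q (proj₂ r)) (zip xs ys)
  All-zip []       _        = []
  All-zip (_ ∷ _)  []       = []
  All-zip (p ∷ ps) (q ∷ qs) = (p , q) ∷ All-zip ps qs

  All-zip-proj₂ : ∀ {Q : Pred B ℓ} (xs : List A) {ys} → All Q ys → All (Q ∘ proj₂) (zip xs ys)
  All-zip-proj₂ xs qs = All.map proj₂ (All-zip (All.universal-U xs) qs)

  AllPairs-zip : ∀ {R : Rel A ℓ₁} {S : Rel B ℓ₂} {xs ys} → AllPairs R xs → AllPairs S ys →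
                 AllPairs (λ r s → R (proj₁ r) (proj₁ s) × S (proj₂ r) (proj₂ s)) (zip xs ys)
  AllPairs-zip []       _        = []
  AllPairs-zip (_ ∷ _)  []       = []
  AllPairs-zip (p ∷ ps) (q ∷ qs) = All-zip p q ∷ AllPairs-zip ps qs

module _ {A : Set a} where

  AllPairs-resp-↭ : ∀ {R : Rel A ℓ} → Symmetric R → ∀ {xs ys} → xs ↭ ys → AllPairs R xs → AllPairs R ys
  AllPairs-resp-↭ {R = R} R-sym p = ↭ₛ.AllPairs-resp-↭ (setoid A) R-sym (resp₂ R) (↭⇒↭ₛ p)

  AllPairs-resp-⊇ : ∀ {R : Rel A ℓ} {xs ys} → xs ⊆ ys → AllPairs R ys → AllPairs R xs
  AllPairs-resp-⊇ []         []       = []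
  AllPairs-resp-⊇ (_ ∷ʳ s)   (_ ∷ rs) = AllPairs-resp-⊇ s rs
  AllPairs-resp-⊇ (refl ∷ s) (r ∷ rs) = All-resp-⊆ s r ∷ AllPairs-resp-⊇ s rs

  ∈⇒↭∷ : ∀ {x : A} {xs} → x ∈ xs → ∃ λ ys → xs ↭ x ∷ ys
  ∈⇒↭∷ x∈xs with ys , zs , refl ← ∈-∃++ x∈xs = ys ++ zs , shift _ ys zs

  pigeonhole : ∀ {P : Pred A ℓ} (P? : Decidable P) m n xs → length xs ≡ m + n →
               (∃ λ ys → ys ⊆ xs × length ys ≡ m × All P ys) ⊎
               (∃ λ ys → ys ⊆ xs × length ys ≡ n × All (λ y → ¬ P y) ys)
  pigeonhole P? zero    n       xs       eq = inj₁ ([] , minimum xs , refl , [])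
  pigeonhole P? (suc m) zero    xs       eq = inj₂ ([] , minimum xs , refl , [])
  pigeonhole P? (suc m) (suc n) (x ∷ xs) eq with P? x
  ... | yes px with pigeonhole P? m (suc n) xs (suc-injective eq)
  ...   | inj₁ (ys , s , l , h) = inj₁ (x ∷ ys , refl ∷ s , cong suc l , px ∷ h)
  ...   | inj₂ (ys , s , l , h) = inj₂ (ys , x ∷ʳ s , l , h)
  pigeonhole P? (suc m) (suc n) (x ∷ xs) eq | no ¬px
      with pigeonhole P? (suc m) n xs (trans (suc-injective eq) (+-suc m n))
  ...   | inj₁ (ys , s , l , h) = inj₁ (ys , x ∷ʳ s , l , h)
  ...   | inj₂ (ys , s , l , h) = inj₂ (x ∷ ys , refl ∷ s , cong suc l , ¬px ∷ h)

Unbounded : Set a → Set a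
Unbounded A = ∀ (xs : List A) → ∃ λ x → All (x ≢_) xs

-- Finite partial maps and their one-point extensions.

module _ {A : Set a} (R : Rel (A × A) ℓ) where

  -- Keeping `R` abstract lets a single back-and-forth construction serve both `Mono` and `Hom`.
  Forth Back : Set (a ⊔ ℓ)
  Forth = ∀ p x → AllPairs R p → All (λ q → x ≢ proj₁ q) p → ∃ λ y → All (R (x , y)) p
  Back  = ∀ p y → AllPairs R p → All (λ q → y ≢ proj₂ q) p → ∃ λ x → All (R (x , y)) p

module Partial (G : Graph a e) where

  private V = Vertex G

  _~_ : Rel V e
  _~_ = Adj G

  ~-sym : Symmetric _~_
  ~-sym = Graph.sym G

  ~⇒≢ : ∀ {x y} → x ~ y → x ≢ y
  ~⇒≢ x~y refl = Graph.irrefl G refl x~y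

  _≁_ : Rel V (a ⊔ e)
  x ≁ y = x ≢ y × ¬ (x ~ y)

  ≁-sym : Symmetric _≁_
  ≁-sym (x≢y , h) = ≢-sym x≢y , h ∘ ~-sym

  Coned : List V → Set (a ⊔ e)
  Coned xs = ∃ λ c → All (c ~_) xs

  Isolated : V → List V → Set (a ⊔ e)
  Isolated x ys = All (x ≁_) ys

  Indep : List V → Set (a ⊔ e)
  Indep = AllPairs _≁_

  Clique : List V → Set (a ⊔ e)
  Clique = AllPairs _~_

  -- A finite partial map is the list of its pairs (x , f x).
  Hom : Rel (V × V) (a ⊔ e)
  Hom p q = proj₁ p ≢ proj₁ q × (proj₁ p ~ proj₁ q → proj₂ p ~ proj₂ q)

  Mono : Rel (V × V) (a ⊔ e)
  Mono p q = proj₁ p ≢ proj₁ q × proj₂ p ≢ proj₂ q × (proj₁ p ~ proj₁ q → proj₂ p ~ proj₂ q)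

  Hom-sym : Symmetric Hom
  Hom-sym (h , k) = ≢-sym h , ~-sym ∘ k ∘ ~-sym

  Mono-sym : Symmetric Mono
  Mono-sym (h , i , k) = ≢-sym h , ≢-sym i , ~-sym ∘ k ∘ ~-sym

  ≁⇒Mono : ∀ {p q} → proj₁ p ≁ proj₁ q → proj₂ p ≢ proj₂ q → Mono p q
  ≁⇒Mono (h , k) i = h , i , λ l → contradiction l k

  ~⇒Mono : ∀ {p q} → proj₁ p ≢ proj₁ q → proj₂ p ~ proj₂ q → Mono p q
  ~⇒Mono h i = h , ~⇒≢ i , λ _ → i

  Transfers : Set (a ⊔ e)
  Transfers = ∀ p → AllPairs Mono p → Coned (map proj₁ p) → Coned (map proj₂ p)

-- Cones, large cliques and isolated points.

module Classical {a e} (em : ExcludedMiddle (a ⊔ e)) (G : Graph a e) where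

  open Partial G

  _≟_ : DecidableEquality (Vertex G)
  x ≟ y = map′ lower lift (em {Lift e (x ≡ y)})

  _~?_ : Decidable₂ _~_
  x ~? y = map′ lower lift (em {Lift a (x ~ y)})

-- The hypotheses are conditions that pass to the complement: `Transfers` is a weak form of
-- `Forth Mono`, and in the complement it follows from `Back Mono` of the graph.
module Cones {a e} (em : ExcludedMiddle (a ⊔ e)) (G : Graph a e)
             (fresh : Unbounded (Vertex G))
             (transfer : Partial.Transfers G)
             (back : Back (Partial.Mono G)) where

  private V = Vertex G
  open Partial G
  open Classical em G

  transfer-zip : ∀ {xs ys} → length xs ≡ length ys → AllPairs Mono (zip xs ys) → Coned xs → Coned ys
  transfer-zip {xs} {ys} eq p c =
    subst Coned (map-proj₂-zip xs ys eq)
      (transfer _ p (subst Coned (sym (map-proj₁-zip xs ys eq)) c))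

  -- A map out of an independent set has no edge to preserve; dually, `clique⇒mono` holds because a
  -- map into a clique preserves every edge.
  indep⇒mono : ∀ {xs ys} → Indep xs → Unique ys → AllPairs Mono (zip xs ys)
  indep⇒mono i u = AllPairs.map (λ (h , k) → ≁⇒Mono h k) (AllPairs-zip i u)

  clique⇒mono : ∀ {xs ys} → Unique xs → Clique ys → AllPairs Mono (zip xs ys)
  clique⇒mono u q = AllPairs.map (λ (h , k) → ~⇒Mono h k) (AllPairs-zip u q)

  indep⇒unique : ∀ {xs} → Indep xs → Unique xs
  indep⇒unique = AllPairs.map proj₁

  unique-cover : ∀ xs → ∃ λ ys → Unique ys × (∀ {x} → x ∈ xs → x ∈ ys)
  unique-cover xs = deduplicate _≟_ xs , UniqueDec.deduplicate-! _≟_ xs , ∈-deduplicate⁺ _≟_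

  UniqueConed : ℕ → Set (a ⊔ e)
  UniqueConed n = ∀ xs → Unique xs → length xs ≡ n → Coned xs

  uniqueConed⇒coned : (∀ n → UniqueConed (2 + n)) → ∀ xs → Coned xs
  uniqueConed⇒coned h xs =
    let ys , u , xs⊆ys = unique-cover xs
        -- Two fresh vertices bring the size up to the form `2 + n`.
        y  , y∉  = fresh ys
        z  , z∉  = fresh (y ∷ ys)
        c  , c~ = h (length ys) (z ∷ y ∷ ys) (z∉ ∷ y∉ ∷ u) refl
    in c , All.tabulate (All.lookup (All.tail (All.tail c~)) ∘ xs⊆ys)

  -- Were all neighbourhoods finite, the finitely many neighbours of one
  -- vertex u would together be adjacent to only finitely many vertices,
  -- although every vertex is joined to u by a path of length two.
  infinite-degree : UniqueConed 2 → ∃ λ u → ∀ xs → ∃ λ v → u ~ v × All (v ≢_) xs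
  infinite-degree pairs with em {∃ λ u → ∀ xs → ∃ λ v → u ~ v × All (v ≢_) xs}
  ... | yes h = h
  ... | no ¬h = contradiction v∈ (λ m → All.lookup (proj₂ (fresh vs)) m refl)
    where
    bound : ∀ u → ∃ λ xs → ∀ v → u ~ v → v ∈ xs
    bound u with em {∃ λ xs → ∀ v → u ~ v → v ∈ xs}
    ... | yes h = h
    ... | no ¬b = ⊥-elim (¬h (u , λ xs → decidable-stable em λ ¬v → ¬b (xs , λ v u~v →
            decidable-stable (any? (v ≟_) xs) λ v∉ → ¬v (v , u~v , All.¬Any⇒All¬ xs v∉))))
    nbrs = proj₁ ∘ bound
    u = proj₁ (fresh [])
    vs = u ∷ concatMap nbrs (nbrs u)
    v = proj₁ (fresh vs)
    v∈ : v ∈ vs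
    v∈ with c , (c~v ∷ c~u ∷ []) ← pairs (v ∷ u ∷ []) ((All.head (proj₂ (fresh vs)) ∷ []) ∷ [] ∷ []) refl =
      there (∈-concatMap⁺ nbrs (lose (proj₂ (bound u) c (~-sym c~u)) (proj₂ (bound c) v c~v)))

  -- A vertex of infinite degree cones sets of every size; transferring this along a map onto a
  -- clique of size `m` gives a vertex that enlarges the clique.
  cliques : UniqueConed 2 → ∀ m → ∃ λ q → length q ≡ m × Clique q
  cliques pairs zero    = [] , refl , []
  cliques pairs (suc m) =
    let q , l , cl = cliques pairs m
        ys , l′ , uq , u~ = neighbours m
        c , c~ = transfer-zip (trans l′ (sym l)) (clique⇒mono uq cl) (u , u~)
    in c ∷ q , cong suc l , c~ ∷ cl
    where
    u = proj₁ (infinite-degree pairs)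
    neighbours : ∀ k → ∃ λ ys → length ys ≡ k × Unique ys × All (u ~_) ys
    neighbours zero    = [] , refl , [] , []
    neighbours (suc k) =
      let ys , l , uq , u~ = neighbours k
          v , u~v , v∉ = proj₂ (infinite-degree pairs) ys
      in v ∷ ys , cong suc l , v∉ ∷ uq , u~v ∷ u~

  CliquesConing : List V → Set (a ⊔ e)
  CliquesConing xs = ∀ m → ∃ λ q → length q ≡ m × Clique q × All (λ v → All (v ~_) xs) q

  CliquesMissing : V → Set (a ⊔ e)
  CliquesMissing x = ∀ m → ∃ λ q → length q ≡ m × Clique q × All (λ v → ¬ (v ~ x)) q

  -- By pigeonhole, a clique of `m + n` cones of `xs` has `m` vertices adjacent to `x` or `n` that
  -- are not. If for some `n` the latter is impossible, the former occurs for every `m`.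
  cliques-dichotomy : UniqueConed 2 → ∀ xs → ∃ CliquesMissing ⊎ CliquesConing xs
  cliques-dichotomy pairs [] = inj₂ λ m →
    let q , l , cl = cliques pairs m in q , l , cl , All.universal (λ _ → []) q
  cliques-dichotomy pairs (x ∷ xs) with cliques-dichotomy pairs xs
  ... | inj₁ h = inj₁ h
  ... | inj₂ h with em {CliquesConing (x ∷ xs)}
  ...   | yes k = inj₂ k
  ...   | no ¬k = inj₁ (x , λ n → decidable-stable em λ ¬n → ¬k λ m → coning m n ¬n)
    where
    coning : ∀ m n → ¬ (∃ λ q → length q ≡ n × Clique q × All (λ v → ¬ (v ~ x)) q) →
             ∃ λ q → length q ≡ m × Clique q × All (λ v → All (v ~_) (x ∷ xs)) q
    coning m n ¬n with q , l , cl , q~ ← h (m + n) with pigeonhole (_~? x) m n q l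
    ... | inj₁ (r , s , l′ , r~) =
            r , l′ , AllPairs-resp-⊇ s cl , All.zipWith (λ (i , j) → i ∷ j) (r~ , All-resp-⊆ s q~)
    ... | inj₂ (r , s , l′ , r≁) = ⊥-elim (¬n (r , l′ , AllPairs-resp-⊇ s cl , r≁))

  -- An injection of `ys` into a clique that misses `x` is a monomorphism, and a preimage of `x`
  -- adjacent to a point of `ys` would make `x` adjacent to the clique.
  isolated : UniqueConed 2 → ∀ {xs} → ¬ Coned xs → ∀ ys → ∃ λ x → Isolated x ys
  isolated pairs {xs} ¬c ys with cliques-dichotomy pairs xs
  ... | inj₂ h with (c ∷ []) , refl , _ , (c~ ∷ []) ← h 1 = contradiction (c , c~) ¬c
  ... | inj₁ (x , h) with zs , u , ys⊆zs ← unique-cover ys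
                     -- The spare vertex `q₀` is adjacent to all of `q` but not to `x`, which shows
                     -- that `x` is not in `q`.
                     with (q₀ ∷ q) , l , (q₀~q ∷ cl) , (q₀≁x ∷ q≁x) ← h (suc (length zs)) = 
      let x′ , m = back (zip zs q) x (clique⇒mono u cl)
                     (All-zip-proj₂ zs (All.map (λ q₀~v x≡v → q₀≁x (subst (q₀ ~_) (sym x≡v) q₀~v)) q₀~q))
          iso = All.zipWith (λ ((x′≢ , _ , k) , v≁x) → x′≢ , v≁x ∘ ~-sym ∘ k) (m , All-zip-proj₂ zs q≁x)
          iso′ = subst (Isolated x′) (map-proj₁-zip zs q (sym (suc-injective l))) (All.map⁺ iso)
      in x′ , All.tabulate (All.lookup iso′ ∘ ys⊆zs)

  -- Impossibility of a maximal size `2 + k` with cones.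

  module _ {k} (conedₙ : UniqueConed (2 + k)) (¬conedₙ₊₁ : ¬ UniqueConed (3 + k))
           (isolate : ∀ ys → ∃ λ x → Isolated x ys) where

    indep-isolated : ∀ m ys → ∃ λ ws → length ws ≡ m × Indep ws × (∀ {w y} → w ∈ ws → y ∈ ys → w ≁ y)
    indep-isolated zero    ys = [] , refl , [] , λ ()
    indep-isolated (suc m) ys =
      let ws , l , i , s = indep-isolated m ys
          x , x≁ = isolate (ws ++ ys)
      in x ∷ ws , cong suc l , All.++⁻ˡ ws x≁ ∷ i ,
         λ { (here refl) y∈ → All.lookup (All.++⁻ʳ ws x≁) y∈ ; (there w∈) y∈ → s w∈ y∈ }

    -- Otherwise v ∷ js would be a coned independent set of size 3 + k, and every
    -- set of that size is the image of it under a monomorphism.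
    cone-misses : ∀ {d v js} → Indep js → length js ≡ 2 + k → All (d ~_) js → Isolated v js → d ≁ v
    cone-misses {d} {v} {_ ∷ _} i l d~js@(d~j ∷ _) v≁js@((_ , ¬v~j) ∷ _) =
      (λ d≡v → ¬v~j (subst (_~ _) d≡v d~j)) ,
      λ d~v → ¬conedₙ₊₁ λ xs u l′ →
        transfer-zip (trans (cong suc l) (sym l′)) (indep⇒mono (v≁js ∷ i) u) (d , d~v ∷ d~js)

    indep-coned : ∀ {js} → Indep js → length js ≡ 2 + k → Coned js
    indep-coned i l = conedₙ _ (indep⇒unique i) l

    ≁-zip : ∀ {c c′ ws rs} → All (c ≁_) ws → All (c′ ≢_) rs → All (Mono (c , c′)) (zip ws rs)
    ≁-zip h i = All.map (λ (p , q) → ≁⇒Mono p q) (All-zip h i)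

    -- The source is a set of size `3 + k` with a single edge: `x` cones an independent set `js`,
    -- and some neighbour `d` of `x` is adjacent to exactly one point `j` of `js`. Then `x` cones
    -- `j ∷ d ∷ ws`.
    edge-coned : ∀ {a b rs} → a ~ b → Unique (a ∷ b ∷ rs) → length rs ≡ 1 + k → Coned (a ∷ b ∷ rs)
    edge-coned {a} {b} {rs} a~b ((_ ∷ a∉) ∷ b∉ ∷ u) l
      with js , lj , ij , _ ← indep-isolated (2 + k) []
      with x , x~js ← indep-coned ij lj
      with vs@(v₀ ∷ _) , lv , iv , vs≁ ← indep-isolated (1 + k) (x ∷ js)
      with d , (d~x ∷ d~vs) ← conedₙ (x ∷ vs)
             (All.tabulate (λ v∈ → ≢-sym (proj₁ (vs≁ v∈ (here refl)))) ∷ indep⇒unique iv) (cong suc lv)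
      with any? (d ~?_) js
    -- Were `d` adjacent to no point of `js`, it would be isolated from `js`, and the cone `x` would
    -- miss it.
    ... | no d≁js = contradiction (~-sym d~x) (proj₂ (cone-misses ij lj x~js (All.tabulate λ j∈ →
            (λ d≡j → proj₂ (vs≁ (here refl) (there j∈)) (subst (v₀ ~_) d≡j (~-sym (All.head d~vs)))) ,
            All.lookup (All.¬Any⇒All¬ js d≁js) j∈)))
    ... | yes d~js
      with j , j∈ , d~j ← find d~js
      with ws , js↭ ← ∈⇒↭∷ j∈
      with (j≁ws ∷ iw) ← AllPairs-resp-↭ ≁-sym js↭ ij
      with (x~j ∷ x~ws) ← All-resp-↭ js↭ x~js =
      let lw = suc-injective (trans (sym (↭-length js↭)) lj)
          ws⊆ = λ {w} (w∈ : w ∈ ws) → ∈-resp-↭ (↭-sym js↭) (there w∈)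
          -- Also `d` cones the independent set `j ∷ vs`, so it misses the other points of `js`,
          -- which are isolated from that set.
          d≁ws = All.tabulate λ w∈ →
            cone-misses (All.tabulate (λ v∈ → ≁-sym (vs≁ v∈ (there j∈))) ∷ iv) (cong suc lv) (d~j ∷ d~vs)
              (≁-sym (All.lookup j≁ws w∈) ∷ All.tabulate λ v∈ → ≁-sym (vs≁ v∈ (there (ws⊆ w∈))))
      in transfer-zip (cong (2 +_) (trans lw (sym l)))
           ( (~⇒Mono (≢-sym (~⇒≢ d~j)) a~b ∷ ≁-zip j≁ws a∉)
           ∷ ≁-zip d≁ws b∉
           ∷ indep⇒mono iw u)
           (x , x~j ∷ ~-sym d~x ∷ x~ws)

    -- A neighbour of x whose only neighbour in the independent set w ∷ ws is w.
    record Partner (x w : V) (ws ys : List V) : Set (a ⊔ e) where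
      field
        partner  : V
        others   : List V
        ~apex    : partner ~ x
        ~mate    : partner ~ w
        ~others  : All (partner ~_) others
        ≁ws      : Isolated partner ws
        length≡  : length others ≡ 1 + k
        indep    : Indep (w ∷ others)
        others≁  : ∀ {v y} → v ∈ others → y ∈ ws ++ ys → v ≁ y

      misses : ∀ {v} → Isolated v (w ∷ others) → partner ≁ v
      misses = cone-misses indep (cong suc length≡) (~mate ∷ ~others)

    -- The edge between `x` and `w` gives a cone of these two and `1 + k` isolated points; it cones
    -- an independent set containing `w`, hence misses `ws`. The list `ys` keeps `others` away from
    -- an earlier choice.
    partner : ∀ {x w ws} → Indep (w ∷ ws) → All (x ~_) (w ∷ ws) → ∀ ys → Partner x w ws ys
    partner {x} {w} {ws} (w≁ws ∷ iw) (x~w ∷ x~ws) ys =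
      let vs , lv , iv , vs≁ = indep-isolated (1 + k) (x ∷ w ∷ ws ++ ys)
          w≁vs = All.tabulate λ v∈ → ≁-sym (vs≁ v∈ (there (here refl)))
          d , d~ = edge-coned x~w
            ( (~⇒≢ x~w ∷ All.tabulate (λ v∈ → ≢-sym (proj₁ (vs≁ v∈ (here refl)))))
            ∷ indep⇒unique (w≁vs ∷ iv)) lv
      in record
        { partner = d
        ; others  = vs
        ; ~apex   = All.head d~
        ; ~mate   = All.head (All.tail d~)
        ; ~others = All.tail (All.tail d~)
        ; ≁ws     = All.tabulate λ w′∈ → cone-misses (w≁vs ∷ iv) (cong suc lv) (All.tail d~)
            ( ≁-sym (All.lookup w≁ws w′∈)
            ∷ All.tabulate λ v∈ → ≁-sym (vs≁ v∈ (there (there (∈-++⁺ˡ w′∈)))))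
        ; length≡ = lv
        ; indep   = w≁vs ∷ iv
        ; others≁ = λ v∈ y∈ → vs≁ v∈ (there (there y∈))
        }

    partner-≢ : ∀ {x w ws ys d} (π : Partner x w ws ys) → d ∈ ys → d ≢ Partner.partner π
    partner-≢ {ws = ws} record { others = v ∷ _ ; ~others = d~v ∷ _ ; others≁ = vs≁ } d∈ refl =
      proj₂ (vs≁ (here refl) (∈-++⁺ʳ ws d∈)) (~-sym d~v)

    -- The vertex `x` cones `w`, two distinct partners of `w`, and `ws`. All edges of this set lie
    -- among the first three points, which go to the triangle.
    triangle-coned : ∀ {a b c rs} → a ~ b → a ~ c → b ~ c → Unique (a ∷ b ∷ c ∷ rs) → length rs ≡ 1 + k →
                     Coned (a ∷ b ∷ c ∷ rs)
    triangle-coned a~b a~c b~c ((_ ∷ _ ∷ a∉) ∷ (_ ∷ b∉) ∷ c∉ ∷ u) l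
      with w ∷ ws , lj , ij@(w≁ws ∷ iw) , _ ← indep-isolated (2 + k) []
      with x , x~js@(x~w ∷ x~ws) ← indep-coned ij lj = transfer-zip (cong (2 +_) (trans lj (cong suc (sym l))))
        ( (~⇒Mono (≢-sym (~⇒≢ D.~mate)) a~b ∷ ~⇒Mono (≢-sym (~⇒≢ E.~mate)) a~c ∷ ≁-zip w≁ws a∉)
        ∷ (~⇒Mono (partner-≢ E′ (here refl)) b~c ∷ ≁-zip D.≁ws b∉)
        ∷ ≁-zip E.≁ws c∉
        ∷ indep⇒mono iw u)
        (x , x~w ∷ ~-sym D.~apex ∷ ~-sym E.~apex ∷ x~ws)
      where
      D′ = partner ij x~js []
      module D = Partner D′
      E′ = partner ij x~js (D.partner ∷ [])
      module E = Partner E′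

    -- Here the partners belong to two different points `w` and `w′`, and the source has exactly the
    -- two edges joining these points to their partners.
    two-edges-coned : ∀ {a b a′ b′ rs} → a ~ b → a′ ~ b′ → Unique (a ∷ b ∷ a′ ∷ b′ ∷ rs) → length rs ≡ k →
                      Coned (a ∷ b ∷ a′ ∷ b′ ∷ rs)
    two-edges-coned a~b a′~b′
      ((_ ∷ a≢a′ ∷ a≢b′ ∷ a∉) ∷ (b≢a′ ∷ b≢b′ ∷ b∉) ∷ (_ ∷ a′∉) ∷ b′∉ ∷ u) l
      with w ∷ w′ ∷ ws , lj , ij@((w≁w′ ∷ w≁ws) ∷ w′≁ws ∷ iw) , _ ← indep-isolated (2 + k) []
      with x , x~js@(x~w ∷ x~w′ ∷ x~ws) ← indep-coned ij lj = transfer-zip (cong (2 +_) (trans lj (cong (2 +_) (sym l))))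
        ( (~⇒Mono (≢-sym (~⇒≢ D.~mate)) a~b ∷ ≁⇒Mono w≁w′ a≢a′ ∷
           ≁⇒Mono (≁-sym (All.head E.≁ws)) a≢b′ ∷ ≁-zip w≁ws a∉)
        ∷ (≁⇒Mono (All.head D.≁ws) b≢a′ ∷ ≁⇒Mono D≁E b≢b′ ∷ ≁-zip (All.tail D.≁ws) b∉)
        ∷ (~⇒Mono (≢-sym (~⇒≢ E.~mate)) a′~b′ ∷ ≁-zip w′≁ws a′∉)
        ∷ ≁-zip (All.tail E.≁ws) b′∉
        ∷ indep⇒mono iw u)
        (x , x~w ∷ ~-sym D.~apex ∷ x~w′ ∷ ~-sym E.~apex ∷ x~ws)
      where
      module D = Partner (partner ij x~js [])
      module E = Partner (partner ((≁-sym w≁w′ ∷ w′≁ws) ∷ w≁ws ∷ iw) (x~w′ ∷ x~w ∷ x~ws) D.others)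
      D≁E : D.partner ≁ E.partner
      -- The points of `D.others` are isolated from `w′ ∷ E.others`, so `E.partner` misses them; it
      -- misses `w` too, and so `D.partner` misses it.
      D≁E = D.misses (All.head E.≁ws ∷ All.tabulate λ v∈ →
        E.misses (D.others≁ v∈ (here refl) ∷ All.tabulate λ v′∈ → ≁-sym (E.others≁ v′∈ (∈-++⁺ʳ (w ∷ ws) v∈))))

    -- The three sets of size 2 + k pairwise meet but have no common point. Hence they
    -- have pairwise adjacent cones x, y, z, whereas a cone d of x, y, z would need two
    -- neighbours in their union and so, with 1 + k isolated points ts added to x, y, z,
    -- 3 + k independent neighbours.
    module _ {p q r as bs cs}
      (la : length as ≡ k) (lb : length bs ≡ k) (lc : length cs ≡ k)
      (i₁ : Indep (q ∷ r ∷ as)) (i₂ : Indep (r ∷ p ∷ bs)) (i₃ : Indep (q ∷ p ∷ cs))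
      (p≁₁ : Isolated p (q ∷ r ∷ as)) (q≁₂ : Isolated q (r ∷ p ∷ bs)) (r≁₃ : Isolated r (q ∷ p ∷ cs))
      (as≁₂ : All (λ v → Isolated v (r ∷ p ∷ bs)) as)
      (bs≁₁ : All (λ v → Isolated v (q ∷ r ∷ as)) bs)
      (cs≁₁ : All (λ v → Isolated v (q ∷ r ∷ as)) cs)
      (cs≁₂ : All (λ v → Isolated v (r ∷ p ∷ bs)) cs) where

      cone-triangle : ∃ λ x → ∃ λ y → ∃ λ z → x ~ y × x ~ z × y ~ z ×
        All (x ~_) (q ∷ r ∷ as) × All (y ~_) (r ∷ p ∷ bs) × All (z ~_) (q ∷ p ∷ cs)
      cone-triangle
        with x , x~@(x~q ∷ x~r ∷ _) ← indep-coned i₁ (cong (2 +_) la)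
        -- The shared points supply edges: `x` and `r` for the set coned by `y`, then `x`, `q` and
        -- `y`, `p` for the set coned by `z`.
        with y , (y~x ∷ y~@(_ ∷ y~p ∷ _)) ← edge-coned x~r
          ( (~⇒≢ x~r ∷ All.map (proj₁ ∘ cone-misses i₁ (cong (2 +_) la) x~) (p≁₁ ∷ bs≁₁))
          ∷ indep⇒unique i₂) (cong suc lb)
        with z , (z~x ∷ z~q ∷ z~y ∷ z~p∷cs) ← two-edges-coned x~q y~p
          ( (~⇒≢ x~q ∷ ~⇒≢ (~-sym y~x) ∷ All.map (proj₁ ∘ cone-misses i₁ (cong (2 +_) la) x~) (p≁₁ ∷ cs≁₁))
          ∷ (≢-sym (proj₁ (cone-misses i₂ (cong (2 +_) lb) y~ q≁₂)) ∷ All.map proj₁ (AllPairs.head i₃))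
          ∷ (~⇒≢ y~p ∷ All.map (proj₁ ∘ cone-misses i₂ (cong (2 +_) lb) y~) cs≁₂)
          ∷ indep⇒unique (AllPairs.tail i₃)) lc
        = x , y , z , ~-sym y~x , ~-sym z~x , ~-sym z~y , x~ , y~ , z~q ∷ z~p∷cs

      cone-triangle-absurd : ∀ {x y z ts} → x ~ y → x ~ z → y ~ z →
        All (x ~_) (q ∷ r ∷ as) → All (y ~_) (r ∷ p ∷ bs) → All (z ~_) (q ∷ p ∷ cs) →
        length ts ≡ 1 + k → Indep ts →
        (∀ {t v} → t ∈ ts → v ∈ x ∷ y ∷ z ∷ p ∷ q ∷ r ∷ as ++ bs ++ cs → t ≁ v) → ⊥
      cone-triangle-absurd {x} {y} {z} {ts@(t ∷ _)} x~y x~z y~z x~ y~ z~ lt it ts≁ =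
        refute (triangle-coned x~y x~z y~z
          ( (~⇒≢ x~y ∷ ~⇒≢ x~z ∷ All.tabulate (λ t∈ → ≢-sym (proj₁ (ts≁ t∈ (here refl)))))
          ∷ (~⇒≢ y~z ∷ All.tabulate (λ t∈ → ≢-sym (proj₁ (ts≁ t∈ (there (here refl))))))
          ∷ All.tabulate (λ t∈ → ≢-sym (proj₁ (ts≁ t∈ (there (there (here refl))))))
          ∷ indep⇒unique it) lt)
        where
        vs = p ∷ q ∷ r ∷ as ++ bs ++ cs
        ≁ts : ∀ {v} → v ∈ vs → Isolated v ts
        ≁ts v∈ = All.tabulate λ t∈ → ≁-sym (ts≁ t∈ (there (there (there v∈))))
        p∈ : p ∈ vs
        p∈ = here refl
        q∈ : q ∈ vs
        q∈ = there (here refl)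
        r∈ : r ∈ vs
        r∈ = there (there (here refl))
        as∈ : ∀ {v} → v ∈ as → v ∈ vs
        as∈ v∈ = there (there (there (∈-++⁺ˡ v∈)))
        bs∈ : ∀ {v} → v ∈ bs → v ∈ vs
        bs∈ v∈ = there (there (there (∈-++⁺ʳ as (∈-++⁺ˡ v∈))))
        cs∈ : ∀ {v} → v ∈ cs → v ∈ vs
        cs∈ v∈ = there (there (there (∈-++⁺ʳ as (∈-++⁺ʳ bs v∈))))
        ∈₂ : ∀ {v} → v ∈ r ∷ p ∷ bs → v ∈ vs
        ∈₂ (here refl) = r∈
        ∈₂ (there (here refl)) = p∈
        ∈₂ (there (there v∈)) = bs∈ v∈
        ∈₃ : ∀ {v} → v ∈ q ∷ p ∷ cs → v ∈ vs
        ∈₃ (here refl) = q∈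
        ∈₃ (there (here refl)) = p∈
        ∈₃ (there (there v∈)) = cs∈ v∈

        refute : Coned (x ∷ y ∷ z ∷ ts) → ⊥
        -- Each point of the first set is isolated from the second or the third. If `d` were
        -- adjacent to it, `d` would miss that whole set, and hence its cone; so `d` misses the
        -- whole first set, and hence `x`.
        refute (d , d~x ∷ d~y ∷ d~z ∷ d~ts@(d~t ∷ _)) = ¬iso₁
          (miss q∈ d≁q ∷ miss r∈ d≁r ∷ All.tabulate λ v∈ → miss (as∈ v∈) (d≁as v∈))
          where
          -- The set `v ∷ ts` is independent, of size `2 + k` and coned by `d`.
          once : ∀ {v us} → v ∈ vs → d ~ v → Isolated v us → (∀ {u} → u ∈ us → u ∈ vs) → Isolated d us
          once v∈ d~v v≁us us⊆vs = All.tabulate λ u∈ →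
            cone-misses (≁ts v∈ ∷ it) (cong suc lt) (d~v ∷ d~ts)
              (≁-sym (All.lookup v≁us u∈) ∷ ≁ts (us⊆vs u∈))
          miss : ∀ {v} → v ∈ vs → ¬ (d ~ v) → d ≁ v
          miss v∈ ¬d~v =
            (λ d≡v → proj₂ (ts≁ (here refl) (there (there (there v∈)))) (subst (t ~_) d≡v (~-sym d~t))) , ¬d~v
          ¬iso₁ : ¬ Isolated d (q ∷ r ∷ as)
          ¬iso₁ h = proj₂ (cone-misses i₁ (cong (2 +_) la) x~ h) (~-sym d~x)
          ¬iso₂ : ¬ Isolated d (r ∷ p ∷ bs)
          ¬iso₂ h = proj₂ (cone-misses i₂ (cong (2 +_) lb) y~ h) (~-sym d~y)
          ¬iso₃ : ¬ Isolated d (q ∷ p ∷ cs)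
          ¬iso₃ h = proj₂ (cone-misses i₃ (cong (2 +_) lc) z~ h) (~-sym d~z)
          d≁q : ¬ (d ~ q)
          d≁q d~q = ¬iso₂ (once q∈ d~q q≁₂ ∈₂)
          d≁r : ¬ (d ~ r)
          d≁r d~r = ¬iso₃ (once r∈ d~r r≁₃ ∈₃)
          d≁as : ∀ {v} → v ∈ as → ¬ (d ~ v)
          d≁as v∈ d~v = ¬iso₂ (once (as∈ v∈) d~v (All.lookup as≁₂ v∈) ∈₂)

    maximal-absurd : ⊥
    maximal-absurd
      with p , _ ← isolate []
      with q , (q≁p ∷ []) ← isolate (p ∷ [])
      with r , (r≁p ∷ r≁q ∷ []) ← isolate (p ∷ q ∷ [])
      with as , la , ia , as≁ ← indep-isolated k (p ∷ q ∷ r ∷ [])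
      with bs , lb , ib , bs≁ ← indep-isolated k (p ∷ q ∷ r ∷ as)
      with cs , lc , ic , cs≁ ← indep-isolated k (p ∷ q ∷ r ∷ as ++ bs) = absurd
      where
      p≁as : Isolated p as
      p≁as = All.tabulate λ v∈ → ≁-sym (as≁ v∈ (here refl))
      q≁as : Isolated q as
      q≁as = All.tabulate λ v∈ → ≁-sym (as≁ v∈ (there (here refl)))
      r≁as : Isolated r as
      r≁as = All.tabulate λ v∈ → ≁-sym (as≁ v∈ (there (there (here refl))))
      p≁bs : Isolated p bs
      p≁bs = All.tabulate λ v∈ → ≁-sym (bs≁ v∈ (here refl))
      q≁bs : Isolated q bs
      q≁bs = All.tabulate λ v∈ → ≁-sym (bs≁ v∈ (there (here refl)))
      r≁bs : Isolated r bs
      r≁bs = All.tabulate λ v∈ → ≁-sym (bs≁ v∈ (there (there (here refl))))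
      p≁cs : Isolated p cs
      p≁cs = All.tabulate λ v∈ → ≁-sym (cs≁ v∈ (here refl))
      q≁cs : Isolated q cs
      q≁cs = All.tabulate λ v∈ → ≁-sym (cs≁ v∈ (there (here refl)))
      r≁cs : Isolated r cs
      r≁cs = All.tabulate λ v∈ → ≁-sym (cs≁ v∈ (there (there (here refl))))
      i₁ : Indep (q ∷ r ∷ as)
      i₁ = (≁-sym r≁q ∷ q≁as) ∷ r≁as ∷ ia
      i₂ : Indep (r ∷ p ∷ bs)
      i₂ = (r≁p ∷ r≁bs) ∷ p≁bs ∷ ib
      i₃ : Indep (q ∷ p ∷ cs)
      i₃ = (q≁p ∷ q≁cs) ∷ p≁cs ∷ ic
      p≁₁ : Isolated p (q ∷ r ∷ as)
      p≁₁ = ≁-sym q≁p ∷ ≁-sym r≁p ∷ p≁as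
      q≁₂ : Isolated q (r ∷ p ∷ bs)
      q≁₂ = ≁-sym r≁q ∷ q≁p ∷ q≁bs
      r≁₃ : Isolated r (q ∷ p ∷ cs)
      r≁₃ = r≁q ∷ r≁p ∷ r≁cs
      as≁₂ : All (λ v → Isolated v (r ∷ p ∷ bs)) as
      as≁₂ = All.tabulate λ v∈ → as≁ v∈ (there (there (here refl))) ∷ as≁ v∈ (here refl) ∷
               All.tabulate λ u∈ → ≁-sym (bs≁ u∈ (there (there (there v∈))))
      bs≁₁ : All (λ v → Isolated v (q ∷ r ∷ as)) bs
      bs≁₁ = All.tabulate λ v∈ → bs≁ v∈ (there (here refl)) ∷ bs≁ v∈ (there (there (here refl))) ∷
               All.tabulate λ u∈ → bs≁ v∈ (there (there (there u∈)))
      cs≁₁ : All (λ v → Isolated v (q ∷ r ∷ as)) cs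
      cs≁₁ = All.tabulate λ v∈ → cs≁ v∈ (there (here refl)) ∷ cs≁ v∈ (there (there (here refl))) ∷
               All.tabulate λ u∈ → cs≁ v∈ (there (there (there (∈-++⁺ˡ u∈))))
      cs≁₂ : All (λ v → Isolated v (r ∷ p ∷ bs)) cs
      cs≁₂ = All.tabulate λ v∈ → cs≁ v∈ (there (there (here refl))) ∷ cs≁ v∈ (here refl) ∷
               All.tabulate λ u∈ → cs≁ v∈ (there (there (there (∈-++⁺ʳ as u∈))))
      absurd : ⊥
      absurd
        with x , y , z , x~y , x~z , y~z , x~ , y~ , z~ ←
               cone-triangle la lb lc i₁ i₂ i₃ p≁₁ q≁₂ r≁₃ as≁₂ bs≁₁ cs≁₁ cs≁₂
        with ts , lt , it , ts≁ ← indep-isolated (1 + k) (x ∷ y ∷ z ∷ p ∷ q ∷ r ∷ as ++ bs ++ cs)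
        = cone-triangle-absurd la lb lc i₁ i₂ i₃ p≁₁ q≁₂ r≁₃ as≁₂ bs≁₁ cs≁₁ cs≁₂
            x~y x~z y~z x~ y~ z~ lt it ts≁

  all-coned : UniqueConed 2 → ∀ xs → Coned xs
  all-coned pairs = uniqueConed⇒coned unique-coned
    where
    unique-coned : ∀ n → UniqueConed (2 + n)
    unique-coned zero    = pairs
    -- If cones fail at the next size, some list has no cone, which supplies the isolated points.
    unique-coned (suc n) = decidable-stable em λ ¬u → maximal-absurd (unique-coned n) ¬u
      (isolated pairs (proj₂ (decidable-stable (em {∃ λ xs → ¬ Coned xs}) λ ¬∃ →
        ¬u λ xs _ _ → decidable-stable em λ ¬c → ¬∃ (xs , ¬c))))

  -- The ends of an induced path `u`, `v`, `w` form a coned independent pair, which maps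
  -- monomorphically onto any two distinct vertices.
  pairs-coned-or-transitive : UniqueConed 2 ⊎ (∀ {u v w} → u ~ v → v ~ w → u ≢ w → u ~ w)
  pairs-coned-or-transitive with em {∃ λ u → ∃₂ λ v w → u ~ v × v ~ w × u ≁ w}
  ... | yes (u , v , w , u~v , v~w , u≁w) = inj₁ λ where
          xs@(_ ∷ _ ∷ []) uq refl →
            transfer-zip {u ∷ w ∷ []} refl (indep⇒mono ((u≁w ∷ []) ∷ [] ∷ []) uq) (v , ~-sym u~v ∷ v~w ∷ [])
  ... | no ¬h = inj₂ λ u~v v~w u≢w → decidable-stable (_ ~? _) λ ¬u~w → ¬h (_ , _ , _ , u~v , v~w , u≢w , ¬u~w)

-- Countable sets and the back-and-forth construction.

↔ℕ⇒unbounded : ∀ {A : Set a} → A ↔ ℕ → Unbounded A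
↔ℕ⇒unbounded A↔ℕ xs = from (suc (bound xs)) , All.map ≢-bound (≤-bound xs)
  where
  open Inverse A↔ℕ
  bound : List _ → ℕ
  bound xs = sum (map to xs)
  ≤-bound : ∀ xs → All (λ x → to x ≤ bound xs) xs
  ≤-bound []       = []
  ≤-bound (x ∷ xs) = m≤m+n _ _ ∷ All.map (λ h → ≤-trans h (m≤n+m _ (to x))) (≤-bound xs)
  ≢-bound : ∀ {x} → to x ≤ bound xs → from (suc (bound xs)) ≢ x
  ≢-bound h refl = <-irrefl refl (subst (_≤ bound xs) (strictlyInverseˡ _) h)

module _ {A : Set a} {R : Rel A ℓ} (R-sym : Symmetric R) where

  AllPairs-lookup : ∀ {xs} → AllPairs R xs → ∀ {i j} → i ≢ j → R (lookup xs i) (lookup xs j)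
  AllPairs-lookup (_ ∷ _)  {Fin.zero}  {Fin.zero}  i≢j = contradiction refl i≢j
  AllPairs-lookup (r ∷ _)  {Fin.zero}  {Fin.suc j} _   = All.lookup r (∈-lookup j)
  AllPairs-lookup (r ∷ _)  {Fin.suc i} {Fin.zero}  _   = R-sym (All.lookup r (∈-lookup i))
  AllPairs-lookup (_ ∷ rs) {Fin.suc i} {Fin.suc j} i≢j = AllPairs-lookup rs (i≢j ∘ cong Fin.suc)

  AllPairs-∈ : ∀ {xs x y} → AllPairs R xs → x ∈ xs → y ∈ xs → x ≡ y ⊎ R x y
  AllPairs-∈ (_ ∷ _)  (here refl) (here refl) = inj₁ refl
  AllPairs-∈ (r ∷ _)  (here refl) (there y∈)  = inj₂ (All.lookup r y∈)
  AllPairs-∈ (r ∷ _)  (there x∈)  (here refl) = inj₂ (R-sym (All.lookup r x∈))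
  AllPairs-∈ (_ ∷ rs) (there x∈)  (there y∈)  = AllPairs-∈ rs x∈ y∈

module _ {A : Set a} (A↔ℕ : A ↔ ℕ) (_≟_ : DecidableEquality A) {R : Rel (A × A) ℓ}
         (R-sym : Symmetric R) (R⇒≢ : ∀ {p q} → R p q → proj₁ p ≢ proj₁ q)
         (forth : Forth R) (back : Back R) where

  open Inverse A↔ℕ

  private
    Stage : Set _
    Stage = ∃ (AllPairs R)

    cover-domain : ∀ (s : Stage) x → ∃ λ (t : Stage) → proj₁ s ⊑ proj₁ t × ∃ λ y → (x , y) ∈ proj₁ t
    cover-domain s@(p , rs) x with any? (λ q → x ≟ proj₁ q) p
    ... | yes h with (_ , y) , m , refl ← find h = s , id , y , m
    ... | no ¬h with y , r ← forth p x rs (All.¬Any⇒All¬ p ¬h) = ((x , y) ∷ p , r ∷ rs) , there , y , here refl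

    cover-range : ∀ (s : Stage) y → ∃ λ (t : Stage) → proj₁ s ⊑ proj₁ t × ∃ λ x → (x , y) ∈ proj₁ t
    cover-range s@(p , rs) y with any? (λ q → y ≟ proj₂ q) p
    ... | yes h with (x , _) , m , refl ← find h = s , id , x , m
    ... | no ¬h with x , r ← back p y rs (All.¬Any⇒All¬ p ¬h) = ((x , y) ∷ p , r ∷ rs) , there , x , here refl

  -- The graph of `F` is the union of an increasing chain of finite partial maps. Stage `suc n` has
  -- `from n` in its domain and in its range, and `R⇒≢` makes the union single-valued.
  back-and-forth : ∀ {p} → AllPairs R p →
    ∃ λ F → (∀ {x y} → (x , y) ∈ p → F x ≡ y) × (∀ y → ∃ λ x → F x ≡ y) ×
            (∀ {x x′} → x ≢ x′ → R (x , F x) (x′ , F x′))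
  back-and-forth {p₀} rs₀ = F , (λ m → graph⇒≡ (0 , m)) , onto , related
    where
    half stage : ℕ → Stage
    half n = proj₁ (cover-domain (stage n) (from n))
    stage zero    = p₀ , rs₀
    stage (suc n) = proj₁ (cover-range (half n) (from n))

    grows : ∀ n → proj₁ (half n) ⊑ proj₁ (stage (suc n))
    grows n = proj₁ (proj₂ (cover-range (half n) (from n)))

    mono : ∀ m n → proj₁ (stage n) ⊑ proj₁ (stage (m + n))
    mono zero    n = id
    mono (suc m) n = grows (m + n) ∘ proj₁ (proj₂ (cover-domain (stage (m + n)) (from (m + n)))) ∘ mono m n

    Graphed : A × A → Set a
    Graphed q = ∃ λ n → q ∈ proj₁ (stage n)

    consistent : ∀ {q r} → Graphed q → Graphed r → q ≡ r ⊎ R q r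
    consistent {q} (m , q∈) (n , r∈) = AllPairs-∈ R-sym (proj₂ (stage (m + n)))
      (subst (λ k → q ∈ proj₁ (stage k)) (+-comm n m) (mono n m q∈)) (mono m n r∈)

    total : ∀ x → ∃ λ y → Graphed (x , y)
    total x with y , m ← proj₂ (proj₂ (cover-domain (stage (to x)) (from (to x)))) =
      y , suc (to x) , subst (λ z → (z , y) ∈ proj₁ (stage (suc (to x)))) (strictlyInverseʳ x) (grows (to x) m)

    F : A → A
    F = proj₁ ∘ total

    graph⇒≡ : ∀ {x y} → Graphed (x , y) → F x ≡ y
    graph⇒≡ {x} g with consistent (proj₂ (total x)) g
    ... | inj₁ eq = cong proj₂ eq
    ... | inj₂ r  = contradiction refl (R⇒≢ r)

    onto : ∀ y → ∃ λ x → F x ≡ y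
    onto y with x , m ← proj₂ (proj₂ (cover-range (half (to y)) (from (to y)))) =
      x , graph⇒≡ (suc (to y) , subst (λ z → (x , z) ∈ proj₁ (stage (suc (to y)))) (strictlyInverseʳ y) m)

    related : ∀ {x x′} → x ≢ x′ → R (x , F x) (x′ , F x′)
    related {x} {x′} x≢x′ with consistent (proj₂ (total x)) (proj₂ (total x′))
    ... | inj₁ eq = contradiction (cong proj₁ eq) x≢x′
    ... | inj₂ r  = r

-- Complements, and one-point extensions from homogeneity.

complement : Graph a e → Graph a (a ⊔ e)
complement G = record { Vertex = Vertex G ; Adj = _≁_ ; sym = ≁-sym ; irrefl = λ x≡y (x≢y , _) → x≢y x≡y }
  where open Partial G

module _ {a e} (G : Graph a e) where

  open Partial G

  ME⇒extension : ME-Homogeneous G → ∀ {p} → AllPairs Mono p →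
                 ∃ λ F → IsSurjectiveEndomorphism G F × (∀ {q} → q ∈ p → F (proj₁ q) ≡ proj₂ q)
  ME⇒extension me {p} ms =
    -- Both subgraphs are indexed by the positions in `p`, so the monomorphism is `id` on indices.
    let F , surj , r = me (side proj₁ proj₁) (side proj₂ (proj₁ ∘ proj₂)) id
          ((λ {i} {j} h → proj₂ (proj₂ (AllPairs-lookup Mono-sym ms (λ { refl → ~⇒≢ h refl }))) h) , id)
    in F , surj , λ q∈ → subst (λ q → F (proj₁ q) ≡ proj₂ q) (sym (lookup-index q∈)) (r (index q∈))
    where
    side : (π : Vertex G × Vertex G → Vertex G) → (∀ {q r} → Mono q r → π q ≢ π r) → FiniteInducedSubgraph G
    side π π-≢ = record
      { size      = length p
      ; inclusion = mk↣ {to = λ i → π (lookup p i)} λ {i} {j} eq →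
          decidable-stable (i Fin.≟ j) λ i≢j → π-≢ (AllPairs-lookup Mono-sym ms i≢j) eq
      }

  ME⇒transfers : ME-Homogeneous G → Transfers
  ME⇒transfers me p ms (c , c~) =
    let F , (hom , _) , F≡ = ME⇒extension me ms
    in F c , All.map⁺ (All.tabulate λ q∈ → subst (F c ~_) (F≡ q∈) (hom (All.lookup (All.map⁻ c~) q∈)))

  ME⇒back : ME-Homogeneous G → Back Mono
  ME⇒back me p y ms y∉ =
    let F , (hom , surj) , F≡ = ME⇒extension me ms
        x , Fx≡ = surj y
    in x , All.tabulate λ {q} q∈ →
         (λ x≡ → All.lookup y∉ q∈ (trans (sym (Fx≡ refl)) (trans (cong F x≡) (F≡ q∈)))) ,
         All.lookup y∉ q∈ ,
         λ x~ → subst₂ _~_ (Fx≡ refl) (F≡ q∈) (hom x~)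

-- From ME-homogeneity to MB- and HE-homogeneity.

module Homogeneity {a e} (em : ExcludedMiddle (a ⊔ e)) (G : Graph a e) (V↔ℕ : CountablyInfinite G)
                   (me : ME-Homogeneous G) (conn : Connected G) where

  open Partial G
  open Classical em G
  fresh = ↔ℕ⇒unbounded V↔ℕ
  open Cones em G fresh (ME⇒transfers G me) (ME⇒back G me) using (all-coned; pairs-coned-or-transitive)

  coned : ∀ xs → Coned xs
  coned with pairs-coned-or-transitive
  ... | inj₁ pairs   = all-coned pairs
  -- Transitivity along walks makes the connected graph complete, so any fresh vertex is a cone.
  ... | inj₂ ~-trans = λ xs → let x , x∉ = fresh xs in x , All.map (complete (conn _ _)) x∉
    where
    complete : ∀ {x y} → Star _~_ x y → x ≢ y → x ~ y
    complete ε x≢y = contradiction refl x≢y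
    complete {y = y} (_◅_ {j = z} x~z w) x≢y with z ≟ y
    ... | yes refl = x~z
    ... | no z≢y   = ~-trans x~z (complete w z≢y) x≢y

  forth-mono : Forth Mono
  forth-mono p x ms x∉ =
    let y , y~ = coned (map proj₂ p)
    in y , All.zipWith (λ (x≢ , y~) → ~⇒Mono x≢ y~) (x∉ , All.map⁻ y~)

  back-mono : Back Mono
  back-mono = ME⇒back G me

  ME⇒MB : MB-Homogeneous G
  ME⇒MB A B f (hom , inj) =
    let F , F≡ , surj , rel = back-and-forth V↔ℕ _≟_ Mono-sym proj₁ forth-mono back-mono
          (AllPairs.tabulate⁺ {f = λ i → vertex A i , vertex B (f i)} λ i≢j →
             (i≢j ∘ vertex-injective A) , (i≢j ∘ inj ∘ vertex-injective B) , hom)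
    in F ,
       ( (λ x~y → proj₂ (proj₂ (rel (~⇒≢ x~y))) x~y)
       , (λ {x} {y} eq → decidable-stable (x ≟ y) λ x≢y → proj₁ (proj₂ (rel x≢y)) eq)
       , λ y → let x , eq = surj y in x , λ { refl → eq }) ,
       λ i → F≡ (∈-tabulate⁺ i)
    where
    vertex-injective : ∀ (A : FiniteInducedSubgraph G) {i j} → vertex A i ≡ vertex A j → i ≡ j
    vertex-injective A = Injection.injective (FiniteInducedSubgraph.inclusion A)

  forth-hom : Forth Hom
  forth-hom p x _ x∉ =
    let y , y~ = coned (map proj₂ p)
    in y , All.zipWith (λ (x≢ , y~) → x≢ , λ _ → y~) (x∉ , All.map⁻ y~)

  module Ḡ = Partial (complement G)

  -- By contraposition: preserving non-adjacency means reflecting adjacency.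
  flip-mono : ∀ {p} → AllPairs Ḡ.Mono p → AllPairs Mono (map swap p)
  flip-mono = AllPairs.map⁺ ∘ AllPairs.map λ (x≢ , y≢ , h) → y≢ , x≢ , λ y~ →
    decidable-stable (_ ~? _) λ ¬x~ → proj₂ (h (x≢ , ¬x~)) y~

  -- A cone in the complement is an isolated point, which `back-mono` moves along the inverse map;
  -- likewise `complement-back` comes from `forth-mono`.
  complement-transfers : Ḡ.Transfers
  complement-transfers p ms (c , c≁) =
    let x , h = back-mono (map swap p) c (flip-mono ms) (All.map⁺ (All.map proj₁ (All.map⁻ c≁)))
    in x , All.map⁺ (All.zipWith (λ ((x≢ , _ , k) , (_ , ¬c~)) → x≢ , ¬c~ ∘ k) (All.map⁻ h , All.map⁻ c≁))

  complement-back : Back Ḡ.Mono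
  complement-back p y ms y∉ =
    let x , h = forth-mono (map swap p) y (flip-mono ms) (All.map⁺ y∉)
    in x , All.map (λ (y≢ , x≢ , k) → x≢ , y≢ , λ (_ , ¬x~) → y≢ , ¬x~ ∘ k) (All.map⁻ h)

  cone-cliques : ∀ m zs → ∃ λ q → length q ≡ m × Clique q × All (λ v → All (v ~_) zs) q
  cone-cliques zero    zs = [] , refl , [] , []
  cone-cliques (suc m) zs =
    let q , l , cl , q~ = cone-cliques m zs
        c , c~ = coned (q ++ zs)
    in c ∷ q , cong suc l , All.++⁻ˡ q c~ ∷ cl , All.++⁻ʳ q c~ ∷ q~

  -- When non-adjacency is transitive, p is replaced by the monomorphism that keeps one
  -- pair (a , b) with b ≁ y and sends the rest of its domain to a clique of cones of
  -- b and y: a preimage x of y under this map is isolated from the class of a.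
  back-hom : Back Hom
  back-hom p y hs y∉
    with Cones.pairs-coned-or-transitive em (complement G) fresh complement-transfers complement-back
  ... | inj₁ pairs =
    let x , x≁ = Cones.all-coned em (complement G) fresh complement-transfers complement-back pairs (map proj₁ p)
    in x , All.map (λ (x≢ , ¬x~) → x≢ , λ x~ → contradiction x~ ¬x~) (All.map⁻ x≁)
  ... | inj₂ ≁-trans with any? (λ q → ¬? (y ~? proj₂ q)) p
  -- All values of `p` are adjacent to `y`, so every edge at a fresh vertex is preserved.
  ...   | no ¬h =
    let x , x∉ = fresh (map proj₁ p)
    in x , All.zipWith (λ (x≢ , ¬¬y~) → x≢ , λ _ → decidable-stable (y ~? _) ¬¬y~)
             (All.map⁻ x∉ , All.¬Any⇒All¬ p ¬h)
  ...   | yes h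
    with (a₀ , b₀) , q∈ , ¬y~b₀ ← find h
    with p′ , p↭ ← ∈⇒↭∷ q∈
    with (h₀ ∷ hs′) ← AllPairs-resp-↭ Hom-sym p↭ hs
    with (y≢b₀ ∷ y∉′) ← All-resp-↭ p↭ y∉
    with q , l , cl , q~ ← cone-cliques (length (map proj₁ p′)) (b₀ ∷ y ∷ [])
    with x , ((x≢a₀ , _ , k) ∷ ms) ← back-mono ((a₀ , b₀) ∷ zip (map proj₁ p′) q) y
           ( All.map (λ (a₀≢ , v~) → ~⇒Mono a₀≢ (~-sym (All.head v~))) (All-zip (All.map⁺ (All.map proj₁ h₀)) q~)
           ∷ AllPairs.map (λ (x≢ , v~) → ~⇒Mono x≢ v~) (AllPairs-zip (AllPairs.map⁺ (AllPairs.map proj₁ hs′)) cl))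
           (y≢b₀ ∷ All-zip-proj₂ (map proj₁ p′) (All.map (λ v~ → ≢-sym (~⇒≢ (All.head (All.tail v~)))) q~)) =
    x , All-resp-↭ (↭-sym p↭)
      ( (x≢a₀ , λ x~a₀ → contradiction (k x~a₀) ¬y~b₀)
      ∷ All.tabulate λ q∈ → related (All.lookup x∉ q∈) (All.lookup h₀ q∈) (All.lookup y∉′ q∈))
    where
    x∉ : All (λ r → x ≢ proj₁ r) p′
    x∉ = All.map⁻ (subst (All (x ≢_)) (map-proj₁-zip (map proj₁ p′) q (sym l)) (All.map⁺ (All.map proj₁ ms)))
    -- If `y` misses `proj₂ r`, then so does `b₀` unless they are equal; hence `a₀` misses
    -- `proj₁ r`, and so does `x`, which misses `a₀`.
    related : ∀ {r} → x ≢ proj₁ r → Hom (a₀ , b₀) r → y ≢ proj₂ r → Hom (x , y) r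
    related x≢ (a₀≢ , k₀) y≢ = x≢ , λ x~ → decidable-stable (y ~? _) λ ¬y~ →
      proj₂ (≁-trans (x≢a₀ , ¬y~b₀ ∘ k)
                     (a₀≢ , λ a₀~ → proj₂ (≁-trans (≢-sym y≢b₀ , ¬y~b₀ ∘ ~-sym) (y≢ , ¬y~) (~⇒≢ (k₀ a₀~))) (k₀ a₀~))
                     x≢) x~

  ME⇒HE : HE-Homogeneous G
  ME⇒HE A B f hom =
    let F , F≡ , surj , rel = back-and-forth V↔ℕ _≟_ Hom-sym proj₁ forth-hom back-hom
          (AllPairs.tabulate⁺ {f = λ i → vertex A i , vertex B (f i)} λ i≢j →
             (i≢j ∘ Injection.injective (FiniteInducedSubgraph.inclusion A)) , hom)
    in F ,
       ( (λ x~y → proj₂ (rel (~⇒≢ x~y)) x~y)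
       , λ y → let x , eq = surj y in x , λ { refl → eq }) ,
       λ i → F≡ (∈-tabulate⁺ i)

theorem8p2 : ∀ {a e} → ExcludedMiddle (a ⊔ e) →
    (G : Graph a e) → CountablyInfinite G → Connected G →
    (HE-Homogeneous G ⇔ ME-Homogeneous G) ×
    (ME-Homogeneous G ⇔ MB-Homogeneous G)
theorem8p2 em G V↔ℕ conn =
  mk⇔ (λ he A B f (hom , _) → he A B f hom) (λ me → Homogeneity.ME⇒HE em G V↔ℕ me conn) ,
  mk⇔ (λ me → Homogeneity.ME⇒MB em G V↔ℕ me conn)
      (λ mb A B f m → let F , (hom , _ , surj) , r = mb A B f m in F , (hom , surj) , r)
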